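{- Let $n$ be a positive integer with the Lehmer property, i.e. $n$ is composite and $\varphi(n)\mid n-1$. Let $K$ denote the number of (distinct) prime divisors of $n$. Then $$ n\leq 2^{2^{K}}-2^{2^{K-1}}. $$
   Context: Here $\varphi$ is Euler's totient function. A composite positive integer $n$ is said to have the Lehmer property (or to be a Lehmer number) if $\varphi(n)$ divides $n-1$. -}

module Defs where

open import Data.List.Base using (List; length; filter; map; upTo)
open import Data.Nat.Base using (ℕ; suc; _∸_)
open import Data.Nat.Coprimality using (coprime?)
open import Data.Nat.Divisibility using (_∣_; _∣?_)
open import Data.Nat.Primality using (Composite; prime?)
open import Data.Product.Base using (_×_)
open import Relation.Nullary.Decidable using (_×-dec_)

range : ℕ → List ℕ
range n = map suc (upTo n)

φ : ℕ → ℕ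
φ n = length (filter (λ k → coprime? k n) (range n))

-- Counts the distinct prime divisors of n for n > 0, since these all lie in
-- range n; the value ω 0 = 0 is junk.
ω : ℕ → ℕ
ω n = length (filter (λ p → prime? p ×-dec (p ∣? n)) (range n))

-- Composite n already entails n > 0 (indeed n > 3), so n ∸ 1 is the true
-- difference.
Lehmer : ℕ → Set
Lehmer n = Composite n × φ n ∣ n ∸ 1

{-# OPTIONS --safe #-}

-- If φ n divides n - 1 then n = p₁ ⋯ pₖ is squarefree and k φ n + 1 = n, so
-- ∏ (1 - 1/pᵢ) < 1/k ≤ 1/2.  Among increasing sequences with such a product,
-- Nielsen's argument compares p₁ ⋯ pᵢ with the partial products of the extremal
-- sequence 3, 5, 17, 257, …: if the former first drop below the latter at i, induct
-- on the remaining primes; if they never do, ∏ (1 - 1/pᵢ) would be too large.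
-- In place of a convexity argument with logarithms, the comparison propagates a
-- bound with integer exponents, each step of which is an instance of AM-GM.
module Submission where

open import Data.List.Base using (List; []; _∷_; _++_; [_]; length; filter; map; upTo)
open import Data.List.Membership.Propositional using (_∈_)
open import Data.List.Membership.Propositional.Properties using (∈-filter⁺; ∈-map⁺; ∈-upTo⁺)
open import Data.List.Properties
  using (filter-++; filter-none; filter-≐; length-++; map-++; upTo-∷ʳ)
open import Data.List.Relation.Unary.All as All using (All; []; _∷_)
import Data.List.Relation.Unary.All.Properties as All
open import Data.List.Relation.Unary.AllPairs using (AllPairs; []; _∷_)
open import Data.List.Relation.Unary.Linked using (Linked; _∷_)
import Data.List.Relation.Unary.Linked.Properties as Linked
open import Data.Nat.Base
open import Data.Nat.Coprimality as Coprime using (Coprime; coprime?; coprime-+; coprime-divisor)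
open import Data.Nat.Divisibility
open import Data.Nat.ListAction using (product)
open import Data.Nat.ListAction.Properties using (product≢0; ∈⇒∣product)
open import Data.Nat.Primality
open import Data.Nat.Primality.Factorisation
open import Data.Nat.Properties
open import Data.Nat.Tactic.RingSolver using (solve-∀)
open import Data.Product.Base using (_×_; _,_; proj₁; proj₂)
open import Data.Sum.Base using (inj₁; inj₂)
open import Defs using (Lehmer; range; φ; ω)
open import Function.Base using (_∘_)
open import Level using (0ℓ)
open import Relation.Binary.PropositionalEquality
  using (_≡_; _≢_; refl; sym; trans; cong; cong₂; subst; subst₂; module ≡-Reasoning)
open import Relation.Nullary.Decidable.Core using (yes; no; ¬?; _×-dec_)
open import Relation.Nullary.Negation using (¬_; contradiction)
open import Relation.Unary using (Pred; Decidable; _≐_)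

-- Bernoulli's inequality and weighted AM-GM over the naturals.

*-distrib-^ : ∀ a b k → (a * b) ^ k ≡ a ^ k * b ^ k
*-distrib-^ a b zero    = refl
*-distrib-^ a b (suc k) rewrite *-distrib-^ a b k = [m*n]*[o*p]≡[m*o]*[n*p] a b (a ^ k) (b ^ k)

2ab≤a²+b² : ∀ a b → 2 * (a * b) ≤ a * a + b * b
2ab≤a²+b² a b with ≤-total a b
... | inj₁ a≤b with d , refl ← m≤n⇒∃[o]m+o≡n a≤b =
  subst (2 * (a * (a + d)) ≤_) (lemma a d) (m≤m+n _ (d * d))
  where
  lemma : ∀ a d → 2 * (a * (a + d)) + d * d ≡ a * a + (a + d) * (a + d)
  lemma = solve-∀
... | inj₂ b≤a with d , refl ← m≤n⇒∃[o]m+o≡n b≤a =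
  subst (2 * ((b + d) * b) ≤_) (lemma b d) (m≤m+n _ (d * d))
  where
  lemma : ∀ b d → 2 * ((b + d) * b) + d * d ≡ (b + d) * (b + d) + b * b
  lemma = solve-∀

-- The tangent line of t ↦ t ^ (k + 1) at a lies below its graph.
bernoulli : ∀ k a b → suc k * (a ^ k * b) ≤ b ^ suc k + k * a ^ suc k
bernoulli zero    a b = ≤-reflexive (lemma b)
  where
  lemma : ∀ b → 1 * (1 * b) ≡ b * 1 + 0
  lemma = solve-∀
-- The summand `k * (a * u * b)` added to both sides completes a factor `2 * (a * b)`; the same term
-- is left over after the induction hypothesis and cancels.
bernoulli (suc k) a b = +-cancelʳ-≤ (k * (a * u * b)) _ _ (begin
  suc (suc k) * (a * u * b) + k * (a * u * b)
    ≡⟨ lemma₁ k a b u ⟩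
  suc k * u * (2 * (a * b))
    ≤⟨ *-monoʳ-≤ (suc k * u) (2ab≤a²+b² a b) ⟩
  suc k * u * (a * a + b * b)
    ≡⟨ lemma₂ k a b u ⟩
  suc k * (u * b) * b + suc k * (a * (a * u))
    ≤⟨ +-monoˡ-≤ _ (*-monoˡ-≤ b (bernoulli k a b)) ⟩
  (b * v + k * (a * u)) * b + suc k * (a * (a * u))
    ≡⟨ lemma₃ k a b u v ⟩
  b * (b * v) + suc k * (a * (a * u)) + k * (a * u * b) ∎)
  where
  open ≤-Reasoning
  u = a ^ k
  v = b ^ k
  lemma₁ : ∀ k a b u → (2 + k) * (a * u * b) + k * (a * u * b) ≡ (1 + k) * u * (2 * (a * b))
  lemma₁ = solve-∀
  lemma₂ : ∀ k a b u → (1 + k) * u * (a * a + b * b) ≡ (1 + k) * (u * b) * b + (1 + k) * (a * (a * u))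
  lemma₂ = solve-∀
  lemma₃ : ∀ k a b u v → (b * v + k * (a * u)) * b + (1 + k) * (a * (a * u))
         ≡ b * (b * v) + (1 + k) * (a * (a * u)) + k * (a * u * b)
  lemma₃ = solve-∀

-- AM-GM for y copies of m / y and one copy of 1.
am-gm : ∀ y m → 0 < y → (suc y * m) ^ y * suc y ≤ (y * suc m) ^ y * suc m
am-gm y m 0<y = *-cancelˡ-≤ y {{>-nonZero 0<y}} (+-cancelʳ-≤ (y * (a * u)) _ _ (begin
  y * (u * suc y) + y * (a * u)  ≡⟨ lemma₁ y m u ⟩
  suc y * (u * b)                ≤⟨ bernoulli y a b ⟩
  b * v + y * (a * u)            ≡⟨ cong (_+ y * (a * u)) (lemma₂ y m v) ⟩
  y * (v * suc m) + y * (a * u)  ∎))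
  where
  open ≤-Reasoning
  -- `a` is the repeated term `m / y` and `b` the mean `(m + 1) / (y + 1)`, both scaled by
  -- `y * suc y`.
  a = suc y * m
  b = y * suc m
  u = a ^ y
  v = b ^ y
  lemma₁ : ∀ y m u → y * (u * (1 + y)) + y * ((1 + y) * m * u) ≡ (1 + y) * (u * (y * (1 + m)))
  lemma₁ = solve-∀
  lemma₂ : ∀ y m v → y * (1 + m) * v ≡ y * (v * (1 + m))
  lemma₂ = solve-∀

-- Calculus of inequalities `P ^ y * p ≤ Q ^ y * q`.

power-base-≤ : ∀ y {P Q p q} → 0 < y → 0 < q → q ≤ p → P ^ y * p ≤ Q ^ y * q → P ≤ Q
power-base-≤ y {P} {Q} {p} {q} 0<y 0<q q≤p le = ≮⇒≥ λ Q<P → <-irrefl refl (begin-strict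
  Q ^ y * q  <⟨ *-monoˡ-< q {{>-nonZero 0<q}} (^-monoˡ-< y {{>-nonZero 0<y}} Q<P) ⟩
  P ^ y * q  ≤⟨ *-monoʳ-≤ (P ^ y) q≤p ⟩
  P ^ y * p  ≤⟨ le ⟩
  Q ^ y * q  ∎)
  where open ≤-Reasoning

-- Since `q ≤ p`, the inequality forces `P ≤ Q`, so extra factors of the bases preserve it. This
-- brings the exponent up to the predecessor of the next prime, where `am-gm` applies.
power-raise : ∀ {y z P Q p q} → 0 < y → y ≤ z → 0 < q → q ≤ p →
  P ^ y * p ≤ Q ^ y * q → P ^ z * p ≤ Q ^ z * q
power-raise {y} {z} {P} {Q} {p} {q} 0<y y≤z 0<q q≤p le
  with d , refl ← m≤n⇒∃[o]m+o≡n y≤z = begin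
  P ^ (y + d) * p      ≡⟨ split P p ⟩
  P ^ d * (P ^ y * p)  ≤⟨ *-mono-≤ (^-monoˡ-≤ d (power-base-≤ y 0<y 0<q q≤p le)) le ⟩
  Q ^ d * (Q ^ y * q)  ≡⟨ split Q q ⟨
  Q ^ (y + d) * q      ∎
  where
  open ≤-Reasoning
  split : ∀ R r → R ^ (y + d) * r ≡ R ^ d * (R ^ y * r)
  split R r rewrite +-comm y d | ^-distribˡ-+-* R d y = *-assoc (R ^ d) (R ^ y) r

power-* : ∀ z {P Q p q U V u v} → P ^ z * p ≤ Q ^ z * q → U ^ z * u ≤ V ^ z * v →
  (P * U) ^ z * (p * u) ≤ (Q * V) ^ z * (q * v)
power-* z {P} {Q} {p} {q} {U} {V} {u} {v} le₁ le₂ = begin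
  (P * U) ^ z * (p * u)      ≡⟨ regroup P U p u ⟩
  P ^ z * p * (U ^ z * u)    ≤⟨ *-mono-≤ le₁ le₂ ⟩
  Q ^ z * q * (V ^ z * v)    ≡⟨ regroup Q V q v ⟨
  (Q * V) ^ z * (q * v)      ∎
  where
  open ≤-Reasoning
  regroup : ∀ P U p u → (P * U) ^ z * (p * u) ≡ P ^ z * p * (U ^ z * u)
  regroup P U p u rewrite *-distrib-^ P U z = [m*n]*[o*p]≡[m*o]*[n*p] (P ^ z) (U ^ z) p u

-- Nielsen's comparison with the extremal sequence.

product-pred-≤ : ∀ xs → product (map pred xs) ≤ product xs
product-pred-≤ []       = ≤-refl
product-pred-≤ (x ∷ xs) = *-mono-≤ (pred[n]≤n {x}) (product-pred-≤ xs)

product-pred-< : ∀ {x xs} → All NonZero (x ∷ xs) → product (map pred (x ∷ xs)) < product (x ∷ xs)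
product-pred-< {suc x} {xs} (_ ∷ xs≢0) =
  +-mono-≤ (>-nonZero⁻¹ _ {{product≢0 xs≢0}}) (*-monoʳ-≤ x (product-pred-≤ xs))

-- At `s = 2 ^ 2 ^ (K - 1)` this is the bound of the theorem, in a form that is visibly monotone.
oblong : ℕ → ℕ
oblong s = s * pred s

oblong-mono-≤ : ∀ {s t} → s ≤ t → oblong s ≤ oblong t
oblong-mono-≤ s≤t = *-mono-≤ s≤t (pred-mono-≤ s≤t)

-- With a, b, c = suc a the values at the last restart, A = a ∏ x, B = b ∏ (x - 1)
-- and D = c ∏ (x - 1) over the x processed since.  These are compared with the
-- integers t i = c ^ 2 ^ i + 1, for which ∏ (1 - 1/t i) telescopes; suc e is the
-- next c ^ 2 ^ i.  The last hypothesis but one says V ^ y * T ≤ 1, where T ≥ 1 is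
-- the ratio of ∏ x to ∏ (t i), and V that of ∏ (1 - 1/t i) to ∏ (1 - 1/x).
-- Once ∏ x falls below ∏ (t i), the comparison restarts with a = A.
nielsen : ∀ x xs {A B D e y} → 0 < y → y < x → Linked _<_ (x ∷ xs) →
  D ≤ B → 0 < e → e ≤ A →
  (suc e * A) ^ y * A ≤ (D * e) ^ y * e →
  suc (B * product (map pred (x ∷ xs))) ≡ A * product (x ∷ xs) →
  A * product (x ∷ xs) ≤ oblong (suc e ^ (2 ^ length xs))
nielsen x@(suc z) [] {A} {B} {D} {e} {y} 0<y (s≤s y≤z) _ D≤B 0<e e≤A inv eq
  rewrite *-identityʳ e | *-identityʳ z = ≮⇒≥ λ lt → <-irrefl refl (begin-strict
    G ^ z * (e * suc e)     <⟨ *-monoʳ-< (G ^ z) {{m^n≢0 G z {{G≢0}}}} (subst (_< A * x) (*-comm (suc e) e) lt) ⟩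
    -- The last `x` is compared with `suc e` rather than `2 + e`: the extremal sequence ends in
    -- `c ^ 2 ^ i` instead of `t i`, which makes the final product oblong.
    G ^ z * (A * x)         ≤⟨ power-* z (power-raise 0<y y≤z 0<e e≤A inv) (am-gm z e 0<z) ⟩
    H ^ z * (e * suc e)     ≤⟨ *-monoˡ-≤ (e * suc e) (^-monoˡ-≤ z H≤G) ⟩
    G ^ z * (e * suc e)     ∎)
  where
  open ≤-Reasoning
  0<z = ≤-trans 0<y y≤z
  G = suc e * A * (x * e)
  H = D * e * (z * suc e)
  G≢0 : NonZero G
  G≢0 = >-nonZero (*-mono-≤ (*-mono-≤ {1} {suc e} z<s (≤-trans 0<e e≤A)) (*-mono-≤ {1} {x} z<s 0<e))
  lemma₁ : ∀ D e z → D * e * (z * (1 + e)) ≡ D * z * (e * (1 + e))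
  lemma₁ = solve-∀
  lemma₂ : ∀ A e x → A * x * (e * (1 + e)) ≡ (1 + e) * A * (x * e)
  lemma₂ = solve-∀
  -- Up to the common factor `e * suc e` this is `D * z ≤ A * x`, which holds because `B * z` is one
  -- less than `A * x`.
  H≤G : H ≤ G
  H≤G = begin
    H                        ≡⟨ lemma₁ D e z ⟩
    D * z * (e * suc e)      ≤⟨ *-monoˡ-≤ (e * suc e) (begin
      D * z                    ≤⟨ *-monoˡ-≤ z D≤B ⟩
      B * z                    ≤⟨ n≤1+n _ ⟩
      suc (B * z)              ≡⟨ eq ⟩
      A * suc z                ∎) ⟩
    A * suc z * (e * suc e)  ≡⟨ lemma₂ A e x ⟩
    G                        ∎
nielsen x@(suc z) (w ∷ ws) {A} {B} {D} {e} {y} 0<y (s≤s y≤z) (x<w ∷ ws↗) D≤B 0<e e≤A inv eq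
  = begin
    A * (x * product (w ∷ ws))          ≡⟨ *-assoc A x _ ⟨
    A′ * product (w ∷ ws)               ≤⟨ rest (e′ ≤? A′) ⟩
    oblong (suc e′ ^ (2 ^ length ws))   ≡⟨ cong oblong (squared (2 ^ length ws)) ⟩
    oblong (suc e ^ (2 ^ suc (length ws))) ∎
  where
  open ≤-Reasoning
  0<z = ≤-trans 0<y y≤z
  A′ = A * x
  B′ = B * z
  -- `suc e′` is the square of `suc e`, and `2 + e` is the term `t i` that `x` is compared with.
  e′ = e * (2 + e)
  P = product (w ∷ ws)
  Q = product (map pred (w ∷ ws))

  square : ∀ e → (1 + e) * ((1 + e) * 1) ≡ 1 + e * (2 + e)
  square = solve-∀
  squared : ∀ k → suc e′ ^ k ≡ suc e ^ (2 * k)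
  squared k = trans (cong (_^ k) (sym (square e))) (^-*-assoc (suc e) 2 k)

  eq′ : suc (B′ * Q) ≡ A′ * P
  eq′ = trans (cong suc (*-assoc B z Q)) (trans eq (sym (*-assoc A x P)))

  lemma₁ : ∀ A e x → (1 + e) * A * (x * (1 + e)) ≡ (1 + e * (2 + e)) * (A * x)
  lemma₁ = solve-∀
  lemma₂ : ∀ D e z → D * e * (z * (2 + e)) ≡ D * z * (e * (2 + e))
  lemma₂ = solve-∀
  inv′ : (suc e′ * A′) ^ z * A′ ≤ (D * z * e′) ^ z * e′
  inv′ = subst₂ (λ G H → G ^ z * A′ ≤ H ^ z * e′) (lemma₁ A e x) (lemma₂ D e z)
    (power-* z (power-raise 0<y y≤z 0<e e≤A inv) (am-gm z (suc e) 0<z))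

  Q<P : Q < P
  Q<P = product-pred-< (All.map >-nonZero (Linked.Linked⇒All <-trans (<-trans z<s x<w) ws↗))

  1<A′ : 1 < A′
  1<A′ = *-mono-≤ (≤-trans 0<e e≤A) (s≤s 0<z)

  -- Otherwise `A′ * P ≤ 1 + A′ * Q`, whereas `Q < P` makes `A′ * P` exceed `A′ * Q` by at least
  -- `A′ > 1`.
  A′<B′ : A′ < B′
  A′<B′ = ≰⇒> λ B′≤A′ → <-irrefl refl (begin-strict
    A′ * P         ≡⟨ eq′ ⟨
    1 + B′ * Q     ≤⟨ s≤s (*-monoˡ-≤ Q B′≤A′) ⟩
    1 + A′ * Q     <⟨ +-monoˡ-< (A′ * Q) 1<A′ ⟩
    A′ + A′ * Q    ≡⟨ *-suc A′ Q ⟨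
    A′ * suc Q     ≤⟨ *-monoʳ-≤ A′ Q<P ⟩
    A′ * P         ∎)

  rest : _ → A′ * P ≤ oblong (suc e′ ^ (2 ^ length ws))
  rest (yes e′≤A′) = nielsen w ws 0<z (<-trans (n<1+n z) x<w) ws↗ (*-monoˡ-≤ z D≤B)
    (*-mono-≤ 0<e (z<s {suc e})) e′≤A′ inv′ eq′
  -- Restart: `D` becomes `suc A′`, so `A′<B′` serves as `D ≤ B`; `e` becomes `A′`, and the
  -- invariant is an equality. The resulting bound is no larger because `A′ ≤ e′`.
  rest (no e′≰A′) = ≤-trans
    (nielsen w ws 0<z (<-trans (n<1+n z) x<w) ws↗ A′<B′ (<⇒≤ 1<A′) ≤-refl ≤-refl eq′)
    (oblong-mono-≤ (^-monoˡ-≤ (2 ^ length ws) (s≤s (≰⇒≥ e′≰A′))))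

-- Counting the integers from 1 to `n` with a decidable property.

count : {P : Pred ℕ 0ℓ} → Decidable P → ℕ → ℕ
count P? n = length (filter P? (range n))

module _ {P : Pred ℕ 0ℓ} (P? : Decidable P) where

  count-suc : ∀ n → count P? (suc n) ≡ count P? n + length (filter P? [ suc n ])
  count-suc n = begin
    length (filter P? (range (suc n)))                 ≡⟨ cong (λ ks → length (filter P? (map suc ks))) (upTo-∷ʳ n) ⟨
    length (filter P? (map suc (upTo n ++ [ n ])))     ≡⟨ cong (length ∘ filter P?) (map-++ suc (upTo n) [ n ]) ⟩
    length (filter P? (range n ++ [ suc n ]))          ≡⟨ cong length (filter-++ P? (range n) [ suc n ]) ⟩
    length (filter P? (range n) ++ filter P? [ suc n ]) ≡⟨ length-++ (filter P? (range n)) ⟩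
    count P? n + length (filter P? [ suc n ])          ∎
    where open ≡-Reasoning

  indicator-cong : ∀ {Q : Pred ℕ 0ℓ} (Q? : Decidable Q) {j k} → (P j → Q k) → (Q k → P j) →
    length (filter P? [ j ]) ≡ length (filter Q? [ k ])
  indicator-cong Q? {j} {k} P⇒Q Q⇒P with P? j | Q? k
  ... | yes _ | yes _ = refl
  ... | yes p | no ¬q = contradiction (P⇒Q p) ¬q
  ... | no ¬p | yes q = contradiction (Q⇒P q) ¬p
  ... | no _  | no _  = refl

  count-split : ∀ {Q : Pred ℕ 0ℓ} (Q? : Decidable Q) xs → length (filter P? xs) ≡
    length (filter (λ k → P? k ×-dec Q? k) xs) + length (filter (λ k → P? k ×-dec ¬? (Q? k)) xs)
  count-split Q? []       = refl
  count-split Q? (x ∷ xs) with P? x | Q? x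
  ... | yes _ | yes _ = cong suc (count-split Q? xs)
  ... | yes _ | no  _ = trans (cong suc (count-split Q? xs)) (sym (+-suc _ _))
  ... | no  _ | yes _ = count-split Q? xs
  ... | no  _ | no  _ = count-split Q? xs

count-cong : ∀ {P Q : Pred ℕ 0ℓ} (P? : Decidable P) (Q? : Decidable Q) → P ≐ Q →
  ∀ n → count P? n ≡ count Q? n
count-cong P? Q? P≐Q n = cong length (filter-≐ P? Q? P≐Q (range n))

count-+ : ∀ {P : Pred ℕ 0ℓ} (P? : Decidable P) m n →
  count P? (m + n) ≡ count P? m + count (λ k → P? (m + k)) n
count-+     P? m zero    rewrite +-identityʳ m = sym (+-identityʳ _)
count-+ {P} P? m (suc n) = begin
  count P? (m + suc n)                                            ≡⟨ cong (count P?) (+-suc m n) ⟩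
  count P? (suc (m + n))                                          ≡⟨ count-suc P? (m + n) ⟩
  count P? (m + n) + length (filter P? [ suc (m + n) ])           ≡⟨ cong₂ _+_ (count-+ P? m n)
    (indicator-cong P? shifted? (subst P (sym (+-suc m n))) (subst P (+-suc m n))) ⟩
  count P? m + count shifted? n + length (filter shifted? [ suc n ]) ≡⟨ +-assoc (count P? m) _ _ ⟩
  count P? m + (count shifted? n + length (filter shifted? [ suc n ])) ≡⟨ cong (count P? m +_) (count-suc shifted? n) ⟨
  count P? m + count shifted? (suc n)                             ∎
  where
  open ≡-Reasoning
  shifted? = λ k → P? (m + k)

count-periodic : ∀ {P : Pred ℕ 0ℓ} (P? : Decidable P) m → (λ k → P (m + k)) ≐ P →
  ∀ q → count P? (q * m) ≡ q * count P? m
count-periodic P? m period zero    = refl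
count-periodic P? m period (suc q) = begin
  count P? (m + q * m)                                  ≡⟨ count-+ P? m (q * m) ⟩
  count P? m + count (λ k → P? (m + k)) (q * m)         ≡⟨ cong (count P? m +_) (count-cong _ P? period (q * m)) ⟩
  count P? m + count P? (q * m)                         ≡⟨ cong (count P? m +_) (count-periodic P? m period q) ⟩
  count P? m + q * count P? m                           ∎
  where open ≡-Reasoning

All-range : ∀ {P : Pred ℕ 0ℓ} n → (∀ {k} → 0 < k → k ≤ n → P k) → All P (range n)
All-range n h = All.map⁺ (All.applyUpTo⁺₁ _ n (λ k<n → h z<s k<n))

-- Each block `m * p + 1, …, m * p + p` contains exactly one multiple of `p`, its last entry.
count-multiples : ∀ {P : Pred ℕ 0ℓ} (P? : Decidable P) p → 0 < p → ∀ m →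
  count (λ k → P? k ×-dec (p ∣? k)) (m * p) ≡ count (λ l → P? (l * p)) m
count-multiples     P? p@(suc r) _ zero    = refl
count-multiples {P} P? p@(suc r) _ (suc m) = begin
  count R? (p + m * p)                                   ≡⟨ cong (count R?) (+-comm p (m * p)) ⟩
  count R? (m * p + p)                                   ≡⟨ count-+ R? (m * p) p ⟩
  count R? (m * p) + count S? p                          ≡⟨ cong₂ _+_ (count-multiples P? p z<s m) (count-suc S? r) ⟩
  count T? m + (count S? r + length (filter S? [ p ]))   ≡⟨ cong (count T? m +_) (cong₂ _+_ none last) ⟩
  count T? m + length (filter T? [ suc m ])              ≡⟨ count-suc T? m ⟨
  count T? (suc m)                                       ∎
  where
  open ≡-Reasoning
  R? = λ k → P? k ×-dec (p ∣? k)
  S? = λ k → R? (m * p + k)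
  T? = λ l → P? (l * p)
  none : count S? r ≡ 0
  none = cong length (filter-none S? (All-range r λ 0<k k≤r (_ , p∣) →
    >⇒∤ {{>-nonZero 0<k}} (s≤s k≤r) (∣m+n∣m⇒∣n p∣ (n∣m*n m))))
  last : length (filter S? [ p ]) ≡ length (filter T? [ suc m ])
  last = indicator-cong S? T? (λ (h , _) → subst P (+-comm (m * p) p) h)
    (λ h → subst P (+-comm p (m * p)) h , ∣m∣n⇒∣m+n (n∣m*n m) ∣-refl)

-- Euler's totient function on products of primes.

coprime-∣ʳ : ∀ {k m n} → m ∣ n → Coprime k n → Coprime k m
coprime-∣ʳ m∣n c (d∣k , d∣m) = c (d∣k , ∣-trans d∣m m∣n)

coprime-*ʳ : ∀ {p k m} → Prime p → ¬ p ∣ k → Coprime k m → Coprime k (p * m)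
coprime-*ʳ {p} pr p∤k c {d} (d∣k , d∣pm) = c (d∣k , coprime-divisor d⊥p d∣pm)
  where
  d⊥p : Coprime d p
  d⊥p (e∣d , e∣p) with prime⇒irreducible pr e∣p
  ... | inj₁ e≡1  = e≡1
  ... | inj₂ refl = contradiction (∣-trans e∣d d∣k) p∤k

prime>1 : ∀ {p} → Prime p → 1 < p
prime>1 {p} pr = nonTrivial⇒n>1 p {{prime⇒nonTrivial pr}}

coprime⇒∤ : ∀ {p k m} → Prime p → p ∣ m → Coprime k m → ¬ p ∣ k
coprime⇒∤ pr p∣m c p∣k = <⇒≢ (prime>1 pr) (sym (c (p∣k , p∣m)))

count-coprime-multiple : ∀ q m → count (λ k → coprime? k m) (q * m) ≡ q * φ m
count-coprime-multiple q m = count-periodic (λ k → coprime? k m) m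
  ( (λ {k} c {d} (d∣k , d∣m) → c (∣m∣n⇒∣m+n d∣m d∣k , d∣m))
  , λ {k} → coprime-+ {k} {m} ) q

-- Being coprime to `p * m` and to `m` coincide here, and the latter is periodic modulo `m`.
φ-*-∣ : ∀ {p m} → Prime p → p ∣ m → φ (p * m) ≡ p * φ m
φ-*-∣ {p} {m} pr p∣m = trans
  (count-cong (λ k → coprime? k (p * m)) (λ k → coprime? k m)
    ( (λ {k} → coprime-∣ʳ {k} (n∣m*n p))
    , λ {k} c → coprime-*ʳ {p} {k} pr (coprime⇒∤ {p} {k} pr p∣m c) c ) (p * m))
  (count-coprime-multiple p m)

-- Of the `p * φ m` integers up to `p * m` coprime to `m`, the multiples of `p` number `φ m`; the
-- others are those coprime to `p * m`.
φ-*-∤ : ∀ {p m} → Prime p → ¬ p ∣ m → φ (p * m) ≡ pred p * φ m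
φ-*-∤ {p@(suc r)} {m} pr p∤m = +-cancelˡ-≡ (φ m) _ _ (sym (begin
  p * φ m                                                  ≡⟨ count-coprime-multiple p m ⟨
  count C? (p * m)                                         ≡⟨ count-split C? (p ∣?_) (range (p * m)) ⟩
  count M? (p * m) + count N? (p * m)
    ≡⟨ cong₂ _+_ multiples nonmultiples ⟩
  φ m + φ (p * m)                                          ∎))
  where
  open ≡-Reasoning
  C? = λ k → coprime? k m
  M? = λ k → C? k ×-dec (p ∣? k)
  N? = λ k → C? k ×-dec ¬? (p ∣? k)
  multiples : count M? (p * m) ≡ φ m
  multiples = trans (cong (count M?) (*-comm p m)) (trans (count-multiples C? p z<s m)
    (count-cong (λ l → coprime? (l * p) m) C?
      ( (λ {l} c → Coprime.sym (coprime-∣ʳ {m} {l} (m∣m*n p) (Coprime.sym c)))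
      , λ {l} c → Coprime.sym (subst (Coprime m) (*-comm p l) (coprime-*ʳ {p} {m} pr p∤m (Coprime.sym c)))) m))
  nonmultiples : count N? (p * m) ≡ φ (p * m)
  nonmultiples = count-cong N? (λ k → coprime? k (p * m))
    ( (λ {k} (c , p∤k) → coprime-*ʳ {p} {k} pr p∤k c)
    , λ {k} c → (λ {d} → coprime-∣ʳ {k} {m} {p * m} (n∣m*n p) c {d}) , coprime⇒∤ {p} {k} {p * m} pr (m∣m*n m) c ) (p * m)

∤-product : ∀ {p ps} → Prime p → All Prime ps → All (p <_) ps → ¬ p ∣ product ps
∤-product pr prs p<ps p∣ =
  <-irrefl refl (All.lookup p<ps (factorisationHasAllPrimeFactors pr p∣ prs))

φ-product : ∀ {ps} → All Prime ps → AllPairs _<_ ps → φ (product ps) ≡ product (map pred ps)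
φ-product []         []            = refl
φ-product {p ∷ ps} (pr ∷ prs) (p<ps ∷ ps↗) =
  trans (φ-*-∤ pr (∤-product pr prs p<ps)) (cong (pred p *_) (φ-product prs ps↗))

product-∣ : ∀ {n ps} → All Prime ps → AllPairs _<_ ps → All (_∣ n) ps → product ps ∣ n
product-∣ []         []            []          = 1∣ _
product-∣ {ps = p ∷ ps} (pr ∷ prs) (p<ps ∷ ps↗) (p∣n ∷ ps∣n)
  with divides q refl ← product-∣ prs ps↗ ps∣n
  with euclidsLemma q (product ps) pr p∣n
... | inj₁ p∣q = *-monoˡ-∣ (product ps) p∣q
... | inj₂ p∣Π = contradiction p∣Π (∤-product pr prs p<ps)

-- Lehmer numbers as products of distinct primes.

primeDivisors : ℕ → List ℕ
primeDivisors n = filter (λ p → prime? p ×-dec (p ∣? n)) (range n)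

primeDivisors-increasing : ∀ n → Linked _<_ (primeDivisors n)
primeDivisors-increasing n = Linked.filter⁺ _ <-trans
  (Linked.map⁺ (Linked.applyUpTo⁺₂ _ n (λ i → n<1+n (suc i))))

primeDivisors-sound : ∀ n → All (λ p → Prime p × p ∣ n) (primeDivisors n)
primeDivisors-sound n = All.all-filter _ (range n)

primeDivisors-complete : ∀ {n p} → .{{NonZero n}} → Prime p → p ∣ n → p ∈ primeDivisors n
primeDivisors-complete {n} {zero}  pr _ = contradiction (prime>1 pr) λ ()
primeDivisors-complete {n} {suc p} pr p∣n =
  ∈-filter⁺ _ (∈-map⁺ suc (∈-upTo⁺ (∣⇒≤ p∣n))) (pr , p∣n)

-- The product of the prime divisors divides `n`. A prime factor of the cofactor would be one of
-- these divisors again, so its square would divide `n`.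
squarefree⇒product : ∀ n → .{{NonZero n}} → (∀ {p} → Prime p → ¬ p * p ∣ n) →
  n ≡ product (primeDivisors n)
squarefree⇒product n sqfree with product-∣
    (All.map proj₁ (primeDivisors-sound n))
    (Linked.Linked⇒AllPairs <-trans (primeDivisors-increasing n))
    (All.map proj₂ (primeDivisors-sound n))
... | divides zero eq = contradiction eq (≢-nonZero⁻¹ n)
... | divides q@(suc _) eq with factorise q
...   | record { factors = [] ; isFactorisation = q≡1 } =
  trans eq (trans (cong (_* product (primeDivisors n)) q≡1) (*-identityˡ _))
...   | record { factors = p ∷ ps ; isFactorisation = q≡Π ; factorsPrime = pr ∷ _ } =
  contradiction (subst (p * p ∣_) (sym eq) (*-pres-∣ p∣q (∈⇒∣product p∈))) (sqfree pr)
  where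
  p∣q : p ∣ q
  p∣q = subst (p ∣_) (sym q≡Π) (m∣m*n (product ps))
  p∈ : p ∈ primeDivisors n
  p∈ = primeDivisors-complete pr (∣-trans p∣q (divides (product (primeDivisors n)) (trans eq (*-comm q _))))

-- If `p * p` divides `n`, then `p` divides `φ n`, hence both `n ∸ 1` and `n`.
lehmer⇒squarefree : ∀ {n} → Lehmer n → ∀ {p} → Prime p → ¬ p * p ∣ n
lehmer⇒squarefree {n} (comp , φ∣n-1) {p} pr (divides q refl) =
  <⇒≢ (prime>1 pr) (sym (∣1⇒≡1 (∣m+n∣m⇒∣n p∣n-1+1 p∣n-1)))
  where
  instance _ = composite⇒nonZero comp
  p*⟨q*p⟩≡n : p * (q * p) ≡ n
  p*⟨q*p⟩≡n = trans (*-comm p (q * p)) (*-assoc q p p)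
  p∣n-1 : p ∣ n ∸ 1
  p∣n-1 = ∣-trans (subst (λ n → p ∣ φ n) p*⟨q*p⟩≡n
    (subst (p ∣_) (sym (φ-*-∣ pr (n∣m*n q))) (m∣m*n _))) φ∣n-1
  p∣n-1+1 : p ∣ n ∸ 1 + 1
  p∣n-1+1 = subst (p ∣_) (trans p*⟨q*p⟩≡n (sym (m∸n+n≡m (>-nonZero⁻¹ n)))) (m∣m*n (q * p))

-- This excludes the quotient 1 in `φ n ∣ n ∸ 1`. The tail has product at least `suc Q`, so the
-- whole product is at least `suc x * suc Q`, beyond `suc (x * Q)`.
suc-product-pred≢product : ∀ xs → All (1 <_) xs → 2 ≤ length xs →
  suc (product (map pred xs)) ≢ product xs
suc-product-pred≢product (suc x ∷ xs@(_ ∷ _)) (s≤s 0<x ∷ 1<xs) _ = <⇒≢ (begin-strict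
  suc (x * Q)       <⟨ s≤s (m<m+n (x * Q) 0<x) ⟩
  suc (x * Q + x)   ≡⟨ cong suc (trans (+-comm (x * Q) x) (sym (*-suc x Q))) ⟩
  suc (x * suc Q)   ≤⟨ s≤s (m≤n+m _ Q) ⟩
  suc Q + x * suc Q ≤⟨ *-monoʳ-≤ (suc x) (product-pred-< (All.map (>-nonZero ∘ <⇒≤) 1<xs)) ⟩
  suc x * product xs ∎)
  where
  open ≤-Reasoning
  Q = product (map pred xs)
suc-product-pred≢product (_ ∷ []) _ (s≤s ())

composite-product⇒2≤length : ∀ {ps} → All Prime ps → Composite (product ps) → 2 ≤ length ps
composite-product⇒2≤length {[]}        _  comp =
  contradiction (nonTrivial⇒n>1 1 {{composite⇒nonTrivial comp}}) λ { (s≤s ()) }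
composite-product⇒2≤length {p ∷ []} (pr ∷ []) comp =
  contradiction pr (composite⇒¬prime (subst Composite (*-identityʳ p) comp))
composite-product⇒2≤length {_ ∷ _ ∷ _} _  _    = s≤s (s≤s z≤n)

-- The bound for an increasing list of primes.

oblong≡∸ : ∀ s → oblong s ≡ s * s ∸ s
oblong≡∸ zero = refl
oblong≡∸ (suc s) = sym (trans (cong (_∸ suc s) (*-suc (suc s) s)) (m+n∸m≡n (suc s) (suc s * s)))

bound : ∀ ps k → All Prime ps → Linked _<_ ps → Composite (product ps) →
  product ps ∸ 1 ≡ k * product (map pred ps) →
  product ps ≤ 2 ^ (2 ^ length ps) ∸ 2 ^ (2 ^ (length ps ∸ 1))
bound []           k _  _   comp _  =
  contradiction (composite-product⇒2≤length [] comp) λ ()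
bound ps@(x ∷ xs) k (pr ∷ prs) ps↗ comp eq = begin
  product ps                                         ≡⟨ *-identityˡ _ ⟨
  -- The start has `A = e = y = 1`, `B = k` and `D = c = 2`, giving the sequence 3, 5, 17, ...; the
  -- condition `D ≤ B` is `2 ≤ k`.
  1 * product ps                                     ≤⟨ nielsen x xs z<s (prime>1 pr) ps↗ (2≤k k eq′) z<s ≤-refl ≤-refl
                                                          (trans eq′ (sym (*-identityˡ _))) ⟩
  oblong s                                           ≡⟨ oblong≡∸ s ⟩
  s * s ∸ s                                          ≡⟨ cong (_∸ s) (^-distribˡ-+-* 2 t t) ⟨
  2 ^ (t + t) ∸ s                                    ≡⟨ cong (λ u → 2 ^ (t + u) ∸ s) (+-identityʳ t) ⟨
  2 ^ (2 ^ length ps) ∸ 2 ^ (2 ^ length xs)          ∎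
  where
  open ≤-Reasoning
  t = 2 ^ length xs
  s = 2 ^ t
  eq′ : suc (k * product (map pred ps)) ≡ product ps
  eq′ = trans (cong suc (sym eq)) (suc-pred (product ps) {{composite⇒nonZero comp}})
  2≤k : ∀ k → suc (k * product (map pred ps)) ≡ product ps → 2 ≤ k
  2≤k 0 eq = contradiction (subst NonTrivial (sym eq) (composite⇒nonTrivial comp)) λ ()
  2≤k 1 eq = contradiction (trans (cong suc (sym (*-identityˡ _))) eq)
    (suc-product-pred≢product ps (All.map prime>1 (pr ∷ prs)) (composite-product⇒2≤length (pr ∷ prs) comp))
  2≤k (2+ _) _ = s≤s (s≤s z≤n)

theorem2p2 : (n : ℕ) → Lehmer n →
    n ≤ 2 ^ (2 ^ ω n) ∸ 2 ^ (2 ^ (ω n ∸ 1))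
theorem2p2 n lehmer@(comp , divides k n-1≡kφ) = ≤-trans (≤-reflexive n≡Π)
  (bound ps k primes (primeDivisors-increasing n) (subst Composite n≡Π comp)
    (subst (λ m → m ∸ 1 ≡ k * product (map pred ps)) n≡Π
      (trans n-1≡kφ (cong (k *_) (trans (cong φ n≡Π)
        (φ-product primes (Linked.Linked⇒AllPairs <-trans (primeDivisors-increasing n))))))))
  where
  -- `length ps` is `ω n` by definition, so `bound` speaks of `ω n` directly.
  ps = primeDivisors n
  primes : All Prime ps
  primes = All.map proj₁ (primeDivisors-sound n)
  n≡Π : n ≡ product ps
  n≡Π = squarefree⇒product n {{composite⇒nonZero comp}} (lehmer⇒squarefree lehmer)
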